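{- A function $SO:[0,1]^2\to[0,1]$ is a semi-overlap function if and only if there exist two functions $f,g:[0,1]^2\to[0,1]$ such that $$SO(u,v)=\frac{f(u,v)}{f(u,v)+g(u,v)}\quad\text{for all }u,v\in[0,1],$$ and the following conditions hold: (1) $f(u,v)+g(u,v)\neq 0$ for all $u,v\in[0,1]$; (2) $f$ and $g$ are commutative, i.e. $f(u,v)=f(v,u)$ and $g(u,v)=g(v,u)$; (3) if $uv=0$, then $f(u,v)=0$; (4) if $uv=1$, then $g(u,v)=0$; (5) $f$ is increasing and $g$ is decreasing (in each variable); (6) $f$ is left-continuous and $f+g$ is right-continuous.
   Context: A binary function $h$ on $[0,1]^2$ is called left-continuous if for every $u\in[0,1]$ and every nonempty family $\{v_i\mid i\in I\}\subseteq[0,1]$ one has $h(u,\sup_{i\in I} v_i)=\sup_{i\in I} h(u,v_i)$; right-continuity is the analogous notion with limits from the right (infima). A semi-overlap function is a function $SO:[0,1]^2\to[0,1]$ such that for all $u,v\in[0,1]$: (S1) $SO(u,v)=SO(v,u)$; (S2) if $uv=0$ then $SO(u,v)=0$; (S3) if $uv=1$ then $SO(u,v)=1$; (S4) $SO$ is increasing in each variable; (S5) $SO$ is left-continuous. -}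

module Defs where

open import Level using (Level; _⊔_; suc)
open import Algebra.Bundles using (CommutativeRing)
open import Data.Product using (Σ; ∃; _×_; _,_; proj₁; proj₂)
open import Data.Product.Relation.Binary.Pointwise.NonDependent using (_×ₛ_)
open import Function.Bundles using (Func)
import Relation.Binary.Construct.On as On
open import Relation.Binary.Bundles using (Setoid)
open import Relation.Binary.Core using (Rel)
open import Relation.Binary.Structures using (IsTotalOrder)

module Bounds {c ℓ} {A : Set c} (_≤_ : Rel A ℓ) where

  IsSup : ∀ {i} {I : Set i} → (I → A) → A → Set (c ⊔ ℓ ⊔ i)
  IsSup x s = (∀ j → x j ≤ s) × (∀ t → (∀ j → x j ≤ t) → s ≤ t)

  IsInf : ∀ {i} {I : Set i} → (I → A) → A → Set (c ⊔ ℓ ⊔ i)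
  IsInf x s = (∀ j → s ≤ x j) × (∀ t → (∀ j → t ≤ x j) → t ≤ s)

-- The real numbers, given by their axioms.  Families are indexed by sets at
-- level c ⊔ ℓ₁ ⊔ ℓ₂, which covers every subset Carrier → Set (c ⊔ ℓ₁ ⊔ ℓ₂)
-- through the first projection from its total space.
record CompleteOrderedField (c ℓ₁ ℓ₂ : Level) : Set (suc (c ⊔ ℓ₁ ⊔ ℓ₂)) where
  infix 4 _≤_
  field
    commutativeRing : CommutativeRing c ℓ₁
  open CommutativeRing commutativeRing public
  field
    0≉1          : 0# ≉ 1#
    inverse      : ∀ x → x ≉ 0# → Carrier
    *-inverseʳ   : ∀ x (x≉0 : x ≉ 0#) → x * inverse x x≉0 ≈ 1#
    _≤_          : Rel Carrier ℓ₂
    isTotalOrder : IsTotalOrder _≈_ _≤_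
    +-monoˡ-≤    : ∀ z {x y} → x ≤ y → x + z ≤ y + z
    *-nonNeg     : ∀ {x y} → 0# ≤ x → 0# ≤ y → 0# ≤ x * y
  open Bounds _≤_ public
  field
    complete     : {I : Set (c ⊔ ℓ₁ ⊔ ℓ₂)} → I → (x : I → Carrier) →
                   ∃ (λ b → ∀ j → x j ≤ b) → ∃ (IsSup x)

  divide : Carrier → ∀ y → y ≉ 0# → Carrier
  divide x y y≉0 = x * inverse y y≉0

module UnitSquare {c ℓ₁ ℓ₂} (ℝ : CompleteOrderedField c ℓ₁ ℓ₂) where
  open CompleteOrderedField ℝ public

  𝕀 : Set (c ⊔ ℓ₂)
  𝕀 = Σ Carrier λ x → (0# ≤ x) × (x ≤ 1#)

  val : 𝕀 → Carrier
  val = proj₁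

  𝕀-setoid : Setoid (c ⊔ ℓ₂) ℓ₁
  𝕀-setoid = On.setoid setoid val

  -- Maps [0,1]² → [0,1]; being a Func makes them respect equality of reals
  -- and ignore the proofs of the bounds.
  BinaryOn𝕀 : Set (c ⊔ ℓ₁ ⊔ ℓ₂)
  BinaryOn𝕀 = Func (𝕀-setoid ×ₛ 𝕀-setoid) 𝕀-setoid

  ⟦_⟧ : BinaryOn𝕀 → 𝕀 → 𝕀 → Carrier
  ⟦ h ⟧ u v = val (Func.to h (u , v))

  -- The properties below concern real-valued h, since f + g need not stay
  -- in [0,1].

  _⊕_ : (h k : 𝕀 → 𝕀 → Carrier) → 𝕀 → 𝕀 → Carrier
  (h ⊕ k) u v = h u v + k u v

  Symmetric : (𝕀 → 𝕀 → Carrier) → Set (c ⊔ ℓ₁ ⊔ ℓ₂)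
  Symmetric h = ∀ u v → h u v ≈ h v u

  Increasing : (𝕀 → 𝕀 → Carrier) → Set (c ⊔ ℓ₂)
  Increasing h = (∀ {u u′} v → val u ≤ val u′ → h u v ≤ h u′ v)
               × (∀ u {v v′} → val v ≤ val v′ → h u v ≤ h u v′)

  Decreasing : (𝕀 → 𝕀 → Carrier) → Set (c ⊔ ℓ₂)
  Decreasing h = (∀ {u u′} v → val u ≤ val u′ → h u′ v ≤ h u v)
               × (∀ u {v v′} → val v ≤ val v′ → h u v′ ≤ h u v)

  -- h(u, sup v_j) = sup h(u, v_j) for every nonempty family: whenever s is the
  -- supremum of the v_j, h(u, s) is the supremum of the h(u, v_j).
  LeftContinuous : (𝕀 → 𝕀 → Carrier) → Set (suc (c ⊔ ℓ₁ ⊔ ℓ₂))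
  LeftContinuous h =
    ∀ u {I : Set (c ⊔ ℓ₁ ⊔ ℓ₂)} → I → (v : I → 𝕀) (s : 𝕀) →
    IsSup (λ j → val (v j)) (val s) → IsSup (λ j → h u (v j)) (h u s)

  -- h(u, inf v_j) = inf h(u, v_j) for every nonempty family.
  RightContinuous : (𝕀 → 𝕀 → Carrier) → Set (suc (c ⊔ ℓ₁ ⊔ ℓ₂))
  RightContinuous h =
    ∀ u {I : Set (c ⊔ ℓ₁ ⊔ ℓ₂)} → I → (v : I → 𝕀) (s : 𝕀) →
    IsInf (λ j → val (v j)) (val s) → IsInf (λ j → h u (v j)) (h u s)

  record IsSemiOverlap (SO : BinaryOn𝕀) : Set (suc (c ⊔ ℓ₁ ⊔ ℓ₂)) where
    field
      symmetric      : Symmetric ⟦ SO ⟧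
      zero-boundary  : ∀ u v → val u * val v ≈ 0# → ⟦ SO ⟧ u v ≈ 0#
      one-boundary   : ∀ u v → val u * val v ≈ 1# → ⟦ SO ⟧ u v ≈ 1#
      increasing     : Increasing ⟦ SO ⟧
      leftContinuous : LeftContinuous ⟦ SO ⟧

{-# OPTIONS --safe #-}
module Submission where

-- Forwards, take f = SO and g = 1 − SO.  Backwards, only the left-continuity
-- of f/(f + g) is not routine.  Applied to two-element families,
-- right-continuity makes h = f + g increasing in its second argument.
-- Hence if t bounds all f(u,vⱼ)/h(u,vⱼ) and s = sup vⱼ, then
-- f(u,vⱼ) ≤ t h(u,vⱼ) ≤ t h(u,s) for every j, so f(u,s) ≤ t h(u,s)
-- by the left-continuity of f.

open import Defs
open import Level using (_⊔_; Lift; lift)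
open import Data.Bool.Base using (Bool; true; false)
open import Data.Product using (∃₂; Σ; _×_; _,_; proj₁; proj₂)
open import Data.Sum.Base using (inj₁; inj₂)
open import Function.Bundles using (_⇔_; Func; mk⇔)
open import Relation.Binary.Bundles using (Poset)
open import Relation.Binary.Structures using (IsTotalOrder)
import Algebra.Properties.Ring as RingProperties
import Relation.Binary.Reasoning.PartialOrder as PartialOrderReasoning

-- Ordered-field arithmetic: sums, products, division and cancellation.

module OrderedFieldProperties {c ℓ₁ ℓ₂} (ℝ : CompleteOrderedField c ℓ₁ ℓ₂) where
  open CompleteOrderedField ℝ
  open RingProperties ring
  open IsTotalOrder isTotalOrder using (antisym; total) renaming (isPartialOrder to ≤-isPartialOrder)

  ≤-poset : Poset c ℓ₁ ℓ₂
  ≤-poset = record { isPartialOrder = ≤-isPartialOrder }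

  open PartialOrderReasoning ≤-poset

  +-monoʳ-≤ : ∀ z {x y} → x ≤ y → z + x ≤ z + y
  +-monoʳ-≤ z {x} {y} x≤y = begin
    z + x ≈⟨ +-comm z x ⟩
    x + z ≤⟨ +-monoˡ-≤ z x≤y ⟩
    y + z ≈⟨ +-comm y z ⟩
    z + y ∎

  +-mono-≤ : ∀ {x y z w} → x ≤ y → z ≤ w → x + z ≤ y + w
  +-mono-≤ {x} {y} {z} {w} x≤y z≤w = begin
    x + z ≤⟨ +-monoˡ-≤ z x≤y ⟩
    y + z ≤⟨ +-monoʳ-≤ y z≤w ⟩
    y + w ∎

  x+[y-x]≈y : ∀ x y → x + (y - x) ≈ y
  x+[y-x]≈y x y = begin-equality
    x + (y - x)   ≈⟨ +-congˡ (+-comm y (- x)) ⟩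
    x + (- x + y) ≈⟨ +-assoc x (- x) y ⟨
    x - x + y     ≈⟨ +-congʳ (-‿inverseʳ x) ⟩
    0# + y        ≈⟨ +-identityˡ y ⟩
    y             ∎

  x≤y⇒0≤y-x : ∀ {x y} → x ≤ y → 0# ≤ y - x
  x≤y⇒0≤y-x {x} {y} x≤y = begin
    0#    ≈⟨ -‿inverseʳ x ⟨
    x - x ≤⟨ +-monoˡ-≤ (- x) x≤y ⟩
    y - x ∎

  0≤y⇒x≤x+y : ∀ x {y} → 0# ≤ y → x ≤ x + y
  0≤y⇒x≤x+y x {y} 0≤y = begin
    x      ≈⟨ +-identityʳ x ⟨
    x + 0# ≤⟨ +-monoʳ-≤ x 0≤y ⟩
    x + y  ∎

  -‿anti-mono-≤ : ∀ {x y} → x ≤ y → - y ≤ - x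
  -‿anti-mono-≤ {x} {y} x≤y = begin
    - y           ≤⟨ 0≤y⇒x≤x+y (- y) (x≤y⇒0≤y-x x≤y) ⟩
    - y + (y - x) ≈⟨ +-assoc (- y) y (- x) ⟨
    - y + y - x   ≈⟨ +-congʳ (-‿inverseˡ y) ⟩
    0# - x        ≈⟨ +-identityˡ (- x) ⟩
    - x           ∎

  0≤x⇒y-x≤y : ∀ {x} y → 0# ≤ x → y - x ≤ y
  0≤x⇒y-x≤y {x} y 0≤x = begin
    y - x  ≤⟨ +-monoʳ-≤ y (-‿anti-mono-≤ 0≤x) ⟩
    y - 0# ≈⟨ +-congˡ -0#≈0# ⟩
    y + 0# ≈⟨ +-identityʳ y ⟩
    y      ∎

  -- The order axiom covers only products of nonnegative elements, so the difference carries the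
  -- argument: `y * z` exceeds `x * z` by the nonnegative `(y - x) * z`.
  *-monoˡ-≤ : ∀ {x y z} → 0# ≤ z → x ≤ y → x * z ≤ y * z
  *-monoˡ-≤ {x} {y} {z} 0≤z x≤y = begin
    x * z                   ≤⟨ 0≤y⇒x≤x+y (x * z) (*-nonNeg (x≤y⇒0≤y-x x≤y) 0≤z) ⟩
    x * z + (y - x) * z     ≈⟨ distribʳ z x (y - x) ⟨
    (x + (y - x)) * z       ≈⟨ *-congʳ (x+[y-x]≈y x y) ⟩
    y * z                   ∎

  *-monoʳ-≤ : ∀ {x y z} → 0# ≤ z → x ≤ y → z * x ≤ z * y
  *-monoʳ-≤ {x} {y} {z} 0≤z x≤y = begin
    z * x ≈⟨ *-comm z x ⟩
    x * z ≤⟨ *-monoˡ-≤ 0≤z x≤y ⟩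
    y * z ≈⟨ *-comm y z ⟩
    z * y ∎

  divide-congˡ : ∀ {x x′} y (y≉0 : y ≉ 0#) → x ≈ x′ → divide x y y≉0 ≈ divide x′ y y≉0
  divide-congˡ y y≉0 = *-congʳ

  divide-self : ∀ y (y≉0 : y ≉ 0#) → divide y y y≉0 ≈ 1#
  divide-self = *-inverseʳ

  divide-zero : ∀ y (y≉0 : y ≉ 0#) → divide 0# y y≉0 ≈ 0#
  divide-zero y y≉0 = zeroˡ (inverse y y≉0)

  [x/y]*y≈x : ∀ x y (y≉0 : y ≉ 0#) → divide x y y≉0 * y ≈ x
  [x/y]*y≈x x y y≉0 = begin-equality
    x * inverse y y≉0 * y   ≈⟨ *-assoc x (inverse y y≉0) y ⟩
    x * (inverse y y≉0 * y) ≈⟨ *-congˡ (*-comm (inverse y y≉0) y) ⟩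
    x * (y * inverse y y≉0) ≈⟨ *-congˡ (*-inverseʳ y y≉0) ⟩
    x * 1#                  ≈⟨ *-identityʳ x ⟩
    x                       ∎

  [x*y]/y≈x : ∀ x y (y≉0 : y ≉ 0#) → divide (x * y) y y≉0 ≈ x
  [x*y]/y≈x x y y≉0 = begin-equality
    x * y * inverse y y≉0   ≈⟨ *-assoc x y (inverse y y≉0) ⟩
    x * (y * inverse y y≉0) ≈⟨ *-congˡ (*-inverseʳ y y≉0) ⟩
    x * 1#                  ≈⟨ *-identityʳ x ⟩
    x                       ∎

  *-cancelʳ-≈ : ∀ {x y z} → z ≉ 0# → x * z ≈ y * z → x ≈ y
  *-cancelʳ-≈ {x} {y} {z} z≉0 xz≈yz = begin-equality
    x                  ≈⟨ [x*y]/y≈x x z z≉0 ⟨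
    divide (x * z) z _ ≈⟨ divide-congˡ z z≉0 xz≈yz ⟩
    divide (y * z) z _ ≈⟨ [x*y]/y≈x y z z≉0 ⟩
    y                  ∎

  -- Totality avoids any discussion of the sign of `inverse z`: if `y ≤ x`, multiplying by `z` gives
  -- the reverse inequality, so the two products agree and `z` cancels in the equation.
  *-cancelʳ-≤ : ∀ {x y z} → 0# ≤ z → z ≉ 0# → x * z ≤ y * z → x ≤ y
  *-cancelʳ-≤ {x} {y} {z} 0≤z z≉0 xz≤yz with total x y
  ... | inj₁ x≤y = x≤y
  ... | inj₂ y≤x = begin
    x ≈⟨ *-cancelʳ-≈ z≉0 (antisym xz≤yz (*-monoˡ-≤ 0≤z y≤x)) ⟩
    y ∎

-- Functions on the unit square: complements and right-continuity.

module UnitSquareProperties {c ℓ₁ ℓ₂} (ℝ : CompleteOrderedField c ℓ₁ ℓ₂) where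
  open UnitSquare ℝ
  open OrderedFieldProperties ℝ
  open IsTotalOrder isTotalOrder using () renaming (refl to ≤-refl; trans to ≤-trans)
  open PartialOrderReasoning ≤-poset

  ⟦⟧-nonNeg : ∀ h u v → 0# ≤ ⟦ h ⟧ u v
  ⟦⟧-nonNeg h u v = proj₁ (proj₂ (Func.to h (u , v)))

  ⟦⟧≤1 : ∀ h u v → ⟦ h ⟧ u v ≤ 1#
  ⟦⟧≤1 h u v = proj₂ (proj₂ (Func.to h (u , v)))

  complement : BinaryOn𝕀 → BinaryOn𝕀
  complement h = record
    { to   = λ (u , v) → 1# - ⟦ h ⟧ u v
                       , x≤y⇒0≤y-x (⟦⟧≤1 h u v)
                       , 0≤x⇒y-x≤y 1# (⟦⟧-nonNeg h u v)
    ; cong = λ eq → +-congˡ (-‿cong (Func.cong h eq))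
    }

  complement-decreasing : ∀ h → Increasing ⟦ h ⟧ → Decreasing ⟦ complement h ⟧
  complement-decreasing h (incˡ , incʳ)
    = (λ v u≤u′ → +-monoʳ-≤ 1# (-‿anti-mono-≤ (incˡ v u≤u′)))
    , (λ u v≤v′ → +-monoʳ-≤ 1# (-‿anti-mono-≤ (incʳ u v≤v′)))

  -- Serves the forward direction, where `f + g` is constantly 1. The index `i` supplies a member of
  -- the family to compare a lower bound `t` with.
  constant⇒rightContinuous : ∀ {h a} → (∀ u v → h u v ≈ a) → RightContinuous h
  constant⇒rightContinuous {h} {a} h≈a u {I} i v s _ = lower , greatest
    where
    h≈h : ∀ x y → h u x ≈ h u y
    h≈h x y = trans (h≈a u x) (sym (h≈a u y))

    lower : ∀ j → h u s ≤ h u (v j)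
    lower j = begin
      h u s     ≈⟨ h≈h s (v j) ⟩
      h u (v j) ∎

    greatest : ∀ t → (∀ j → t ≤ h u (v j)) → t ≤ h u s
    greatest t t≤hv = begin
      t         ≤⟨ t≤hv i ⟩
      h u (v i) ≈⟨ h≈h (v i) s ⟩
      h u s     ∎

  -- For `f + g` this does not follow from the monotonicity conditions, since `g` decreases. The
  -- smaller point `v` is the infimum of the pair, so `h u v` lies below the value at the other
  -- point.
  rightContinuous⇒increasingʳ : ∀ {h} → RightContinuous h →
                                ∀ u {v v′} → val v ≤ val v′ → h u v ≤ h u v′
  rightContinuous⇒increasingʳ {h} rc u {v} {v′} v≤v′ =
    proj₁ (rc u (lift true) pair v (lower , λ _ t≤pair → t≤pair (lift true))) (lift false)
    where
    -- `Bool` is lifted to the universe level at which right-continuity quantifies over index sets.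
    pair : Lift (c ⊔ ℓ₁ ⊔ ℓ₂) Bool → 𝕀
    pair (lift true)  = v
    pair (lift false) = v′

    lower : ∀ j → val v ≤ val (pair j)
    lower (lift true)  = ≤-refl
    lower (lift false) = v≤v′

  -- The quotient f/(f + g): boundary values, monotonicity, left-continuity.

  module Quotient
    (f g SO : BinaryOn𝕀)
    (f+g≉0 : ∀ u v → (⟦ f ⟧ ⊕ ⟦ g ⟧) u v ≉ 0#)
    (SO≈f/f+g : ∀ u v → ⟦ SO ⟧ u v ≈ divide (⟦ f ⟧ u v) ((⟦ f ⟧ ⊕ ⟦ g ⟧) u v) (f+g≉0 u v))
    where

    private
      F G H S : 𝕀 → 𝕀 → Carrier
      F = ⟦ f ⟧
      G = ⟦ g ⟧
      H = F ⊕ G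
      S = ⟦ SO ⟧

    H-nonNeg : ∀ u v → 0# ≤ H u v
    H-nonNeg u v = ≤-trans (⟦⟧-nonNeg f u v) (0≤y⇒x≤x+y (F u v) (⟦⟧-nonNeg g u v))

    -- The quotient equation without division, the form in which symmetry, monotonicity and
    -- left-continuity use it.
    S*H≈F : ∀ u v → S u v * H u v ≈ F u v
    S*H≈F u v = trans (*-congʳ (SO≈f/f+g u v)) ([x/y]*y≈x (F u v) (H u v) (f+g≉0 u v))

    symmetric : Symmetric F → Symmetric G → Symmetric S
    symmetric F-sym G-sym u v = *-cancelʳ-≈ (f+g≉0 u v) (begin-equality
      S u v * H u v ≈⟨ S*H≈F u v ⟩
      F u v         ≈⟨ F-sym u v ⟩
      F v u         ≈⟨ S*H≈F v u ⟨
      S v u * H v u ≈⟨ *-congˡ (+-cong (F-sym v u) (G-sym v u)) ⟩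
      S v u * H u v ∎)

    F≈0⇒S≈0 : ∀ u v → F u v ≈ 0# → S u v ≈ 0#
    F≈0⇒S≈0 u v F≈0 = begin-equality
      S u v                  ≈⟨ SO≈f/f+g u v ⟩
      divide (F u v) (H u v) _ ≈⟨ divide-congˡ (H u v) (f+g≉0 u v) F≈0 ⟩
      divide 0# (H u v) _    ≈⟨ divide-zero (H u v) (f+g≉0 u v) ⟩
      0#                     ∎

    G≈0⇒S≈1 : ∀ u v → G u v ≈ 0# → S u v ≈ 1#
    G≈0⇒S≈1 u v G≈0 = begin-equality
      S u v                    ≈⟨ SO≈f/f+g u v ⟩
      divide (F u v) (H u v) _ ≈⟨ divide-congˡ (H u v) (f+g≉0 u v) F≈H ⟩
      divide (H u v) (H u v) _ ≈⟨ divide-self (H u v) (f+g≉0 u v) ⟩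
      1#                       ∎
      where
      F≈H : F u v ≈ H u v
      F≈H = trans (sym (+-identityʳ (F u v))) (+-congˡ (sym G≈0))

    -- Cross-multiplied, the claim is F(F′ + G′) ≤ F′(F + G). The term FF′ occurs on both sides, and
    -- FG′ ≤ F′G holds because all values are nonnegative. Taking two arbitrary points lets one
    -- proof serve both variables.
    S-mono : ∀ u v u′ v′ → F u v ≤ F u′ v′ → G u′ v′ ≤ G u v → S u v ≤ S u′ v′
    S-mono u v u′ v′ F≤F′ G′≤G =
      -- Both denominators are cancelled, first `H u′ v′` and then `H u v`, so the chain compares
      -- products only.
      *-cancelʳ-≤ (H-nonNeg u′ v′) (f+g≉0 u′ v′) (*-cancelʳ-≤ (H-nonNeg u v) (f+g≉0 u v) (begin
        S u v * H u′ v′ * H u v             ≈⟨ swap (S u v) (H u′ v′) (H u v) ⟩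
        S u v * H u v * H u′ v′             ≈⟨ *-congʳ (S*H≈F u v) ⟩
        F u v * H u′ v′                     ≈⟨ distribˡ (F u v) (F u′ v′) (G u′ v′) ⟩
        F u v * F u′ v′ + F u v * G u′ v′   ≤⟨ +-mono-≤ FF′≤F′F FG′≤F′G ⟩
        F u′ v′ * F u v + F u′ v′ * G u v   ≈⟨ distribˡ (F u′ v′) (F u v) (G u v) ⟨
        F u′ v′ * H u v                     ≈⟨ *-congʳ (S*H≈F u′ v′) ⟨
        S u′ v′ * H u′ v′ * H u v           ∎))
      where
      swap : ∀ x y z → x * y * z ≈ x * z * y
      swap x y z = trans (*-assoc x y z) (trans (*-congˡ (*-comm y z)) (sym (*-assoc x z y)))

      FF′≤F′F : F u v * F u′ v′ ≤ F u′ v′ * F u v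
      FF′≤F′F = begin
        F u v * F u′ v′ ≈⟨ *-comm (F u v) (F u′ v′) ⟩
        F u′ v′ * F u v ∎

      FG′≤F′G : F u v * G u′ v′ ≤ F u′ v′ * G u v
      FG′≤F′G = begin
        F u v * G u′ v′   ≤⟨ *-monoˡ-≤ (⟦⟧-nonNeg g u′ v′) F≤F′ ⟩
        F u′ v′ * G u′ v′ ≤⟨ *-monoʳ-≤ (⟦⟧-nonNeg f u′ v′) G′≤G ⟩
        F u′ v′ * G u v   ∎

    increasing : Increasing F → Decreasing G → Increasing S
    increasing (F-incˡ , F-incʳ) (G-decˡ , G-decʳ)
      = (λ {u} {u′} v u≤u′ → S-mono u v u′ v (F-incˡ v u≤u′) (G-decˡ v u≤u′))
      , (λ u {v} {v′} v≤v′ → S-mono u v u v′ (F-incʳ u v≤v′) (G-decʳ u v≤v′))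

    leftContinuous : Increasing S → LeftContinuous F → RightContinuous H → LeftContinuous S
    leftContinuous S-inc F-lc H-rc u {I} i v s sup@(v≤s , _) =
      -- The upper-bound half is monotonicity alone; the continuity hypotheses enter only in
      -- `least`.
      (λ j → proj₂ S-inc u (v≤s j)) , least
      where
      least : ∀ t → (∀ j → S u (v j) ≤ t) → S u s ≤ t
      least t Sv≤t = *-cancelʳ-≤ (H-nonNeg u s) (f+g≉0 u s) (begin
        S u s * H u s ≈⟨ S*H≈F u s ⟩
        F u s         ≤⟨ proj₂ (F-lc u i v s sup) (t * H u s) Fv≤tH ⟩
        t * H u s     ∎)
        where
        -- Multiplying an inequality by `t` requires its sign, which comes from the member of the
        -- family at the given index `i`.
        0≤t : 0# ≤ t
        0≤t = ≤-trans (⟦⟧-nonNeg SO u (v i)) (Sv≤t i)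

        Fv≤tH : ∀ j → F u (v j) ≤ t * H u s
        Fv≤tH j = begin
          F u (v j)             ≈⟨ S*H≈F u (v j) ⟨
          S u (v j) * H u (v j) ≤⟨ *-monoˡ-≤ (H-nonNeg u (v j)) (Sv≤t j) ⟩
          t * H u (v j)         ≤⟨ *-monoʳ-≤ 0≤t (rightContinuous⇒increasingʳ H-rc u (v≤s j)) ⟩
          t * H u s             ∎

theorem3p6 : ∀ {c ℓ₁ ℓ₂} (ℝ : CompleteOrderedField c ℓ₁ ℓ₂) →
    let open UnitSquare ℝ in
    (SO : BinaryOn𝕀) →
    IsSemiOverlap SO
    ⇔
    (∃₂ λ (f g : BinaryOn𝕀) →
    Σ (∀ u v → (⟦ f ⟧ ⊕ ⟦ g ⟧) u v ≉ 0#) λ f+g≉0 →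
    (∀ u v → ⟦ SO ⟧ u v ≈ divide (⟦ f ⟧ u v) ((⟦ f ⟧ ⊕ ⟦ g ⟧) u v) (f+g≉0 u v))
    × (Symmetric ⟦ f ⟧ × Symmetric ⟦ g ⟧)
    × (∀ u v → val u * val v ≈ 0# → ⟦ f ⟧ u v ≈ 0#)
    × (∀ u v → val u * val v ≈ 1# → ⟦ g ⟧ u v ≈ 0#)
    × (Increasing ⟦ f ⟧ × Decreasing ⟦ g ⟧)
    × (LeftContinuous ⟦ f ⟧ × RightContinuous (⟦ f ⟧ ⊕ ⟦ g ⟧)))
theorem3p6 ℝ SO = mk⇔
  (λ so → let open IsSemiOverlap so in
      SO , complement SO , sum≉0 , SO≈quotient
    , (symmetric , λ u v → +-congˡ (-‿cong (symmetric u v)))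
    , zero-boundary
    , (λ u v uv≈1 → trans (+-congˡ (-‿cong (one-boundary u v uv≈1))) (-‿inverseʳ 1#))
    , (increasing , complement-decreasing SO increasing)
    , (leftContinuous , constant⇒rightContinuous sum≈1))
  (λ (f , g , f+g≉0 , SO≈ , (f-sym , g-sym) , f-zero , g-zero , (f-inc , g-dec) , (f-lc , f+g-rc)) →
    let module Q = Quotient f g SO f+g≉0 SO≈
        S-inc = Q.increasing f-inc g-dec
    in record
    { symmetric      = Q.symmetric f-sym g-sym
    ; zero-boundary  = λ u v uv≈0 → Q.F≈0⇒S≈0 u v (f-zero u v uv≈0)
    ; one-boundary   = λ u v uv≈1 → Q.G≈0⇒S≈1 u v (g-zero u v uv≈1)
    ; increasing     = S-inc
    ; leftContinuous = Q.leftContinuous S-inc f-lc f+g-rc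
    })
  where
  open UnitSquare ℝ
  open OrderedFieldProperties ℝ
  open UnitSquareProperties ℝ

  sum≈1 : ∀ u v → (⟦ SO ⟧ ⊕ ⟦ complement SO ⟧) u v ≈ 1#
  sum≈1 u v = x+[y-x]≈y (⟦ SO ⟧ u v) 1#

  sum≉0 : ∀ u v → (⟦ SO ⟧ ⊕ ⟦ complement SO ⟧) u v ≉ 0#
  sum≉0 u v sum≈0 = 0≉1 (trans (sym sum≈0) (sum≈1 u v))

  SO≈quotient : ∀ u v → ⟦ SO ⟧ u v ≈
                divide (⟦ SO ⟧ u v) ((⟦ SO ⟧ ⊕ ⟦ complement SO ⟧) u v) (sum≉0 u v)
  -- Multiplied by the denominator, which equals 1, both sides become `⟦ SO ⟧ u v`; the inverse
  -- itself is never evaluated.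
  SO≈quotient u v = *-cancelʳ-≈ (sum≉0 u v)
    (trans (trans (*-congˡ (sum≈1 u v)) (*-identityʳ _)) (sym ([x/y]*y≈x _ _ _)))
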